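{- Let $m,g,t\ge 1$ be integers. Under the identification of a ruler $(x_0,\dots,x_m)$ with its vector of successive differences $\mathbf{z}=(z_1,\dots,z_m)$, $z_i=x_i-x_{i-1}$, the $B_2^-[g]$-sets with $m+1$ markings and length $t$ are in bijection with the lattice points (points of $\mathbb{Z}^m$) in the interior of $t\Delta_{m-1}$ that are not contained in any subspace of the form $$\sum_{i\in U_0}z_i=\sum_{i\in U_1}z_i=\cdots=\sum_{i\in U_g}z_i,$$ where $U_0,\dots,U_g$ are consecutive subsets of $[m]$, none of which is contained in another.
   Context: A ruler of length $t$ with $m+1$ markings is a sequence of integers $0=x_0<x_1<\cdots<x_{m-1}<x_m=t$. It is a $B_2^-[g]$-set if each positive integer admits at most $g$ representations as a difference of two markings, a representation of $n$ being a pair of indices $i<j$ with $x_j-x_i=n$. $[m]=\{1,\dots,m\}$, and $\Delta_{m-1}=\{\mathbf{z}\in\mathbb{R}^m: z_1,\dots,z_m\ge 0,\ \sum_{i=1}^m z_i=1\}$. The interior of $t\Delta_{m-1}$ means its relative interior, $\{\mathbf{z}: z_i>0\text{ for all }i,\ \sum_i z_i=t\}$. A consecutive subset of $[m]$ is a nonempty set of the form $\{j,j+1,\dots,k\}$. "None of which is contained in another" means $U_a\not\subseteq U_b$ for all indices $a\neq b$ (so in particular the $U_a$ are pairwise distinct). -}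

module Defs where

open import Algebra.Properties.CommutativeMonoid.Sum
  using () renaming (sum to monoidSum)
open import Data.Bool.Base using (if_then_else_)
open import Data.Fin.Base as Fin using (Fin; zero; suc; inject₁; fromℕ)
open import Data.Fin.Properties as Fin using ()
open import Data.Fin.Subset using (Subset; _∈_; _⊈_)
open import Data.Integer.Base using (ℤ; +_; 0ℤ; _-_; _<_)
open import Data.Integer.Properties using (_≟_; +-0-commutativeMonoid)
open import Data.List.Base using (List; length; filter; allFin; cartesianProduct)
open import Data.Nat.Base as ℕ using (ℕ; suc)
open import Data.Product.Base using (Σ; ∃₂; _×_; _,_; proj₁)
open import Data.Vec.Base using (lookup)
open import Data.Vec.Functional using (Vector)
open import Function.Base using (_∘_)
open import Function.Bundles using (_⇔_)
open import Level using (0ℓ)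
open import Relation.Binary.Bundles using (Setoid)
import Relation.Binary.Construct.On as On
open import Relation.Binary.PropositionalEquality using (_≡_; _≢_; _→-setoid_)
open import Relation.Nullary using (¬_)
open import Relation.Nullary.Decidable using (_×-dec_)

sum : ∀ {m} → Vector ℤ m → ℤ
sum = monoidSum +-0-commutativeMonoid

sumOver : ∀ {m} → Subset m → Vector ℤ m → ℤ
sumOver U z = sum (λ i → if lookup U i then z i else 0ℤ)

record Ruler (m t : ℕ) : Set where
  field
    marking    : Vector ℤ (suc m)
    start      : marking zero ≡ 0ℤ
    increasing : ∀ (i : Fin m) → marking (inject₁ i) < marking (suc i)
    end        : marking (fromℕ m) ≡ + t

open Ruler public

-- A list without repetitions, so its length is the number of representations.
representations : ∀ {k} → Vector ℤ k → ℤ → List (Fin k × Fin k)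
representations {k} x n =
  filter (λ (i , j) → (i Fin.<? j) ×-dec (x j - x i ≟ n))
         (cartesianProduct (allFin k) (allFin k))

IsB₂⁻[_] : ∀ (g : ℕ) {k} → Vector ℤ k → Set
IsB₂⁻[ g ] x = ∀ (n : ℤ) → 0ℤ < n → length (representations x n) ℕ.≤ g

-- Index i : Fin m stands for the element toℕ i + 1 of [m], so that
-- differences x i is z_{i+1} = x_{i+1} - x_i.
differences : ∀ {m} → Vector ℤ (suc m) → Vector ℤ m
differences x i = x (suc i) - x (inject₁ i)

-- Membership of a lattice point z in the relative interior of t Δ_{m-1}.
InInterior : ∀ {m} → ℕ → Vector ℤ m → Set
InInterior t z = (∀ i → 0ℤ < z i) × sum z ≡ + t

Consecutive : ∀ {m} → Subset m → Set
Consecutive {m} U =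
  ∃₂ λ (j k : Fin m) → j Fin.≤ k × (∀ i → i ∈ U ⇔ (j Fin.≤ i × i Fin.≤ k))

NoneContained : ∀ {m k} → Vector (Subset m) k → Set
NoneContained U = ∀ a b → a ≢ b → U a ⊈ U b

InSubspace : ∀ {m k} → Vector (Subset m) k → Vector ℤ m → Set
InSubspace U z = ∀ a b → sumOver (U a) z ≡ sumOver (U b) z

AvoidsSubspaces : ∀ {m} → ℕ → Vector ℤ m → Set
AvoidsSubspaces {m} g z =
  ∀ (U : Vector (Subset m) (suc g)) →
  (∀ a → Consecutive (U a)) → NoneContained U → ¬ InSubspace U z

-- In both setoids, equality is pointwise equality of the underlying vectors
-- and ignores the proofs of the defining conditions.

B₂⁻Rulers : (m g t : ℕ) → Setoid 0ℓ 0ℓ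
B₂⁻Rulers m g t =
  On.setoid {B = Σ (Ruler m t) (λ r → IsB₂⁻[ g ] (marking r))}
            (Fin (suc m) →-setoid ℤ) (marking ∘ proj₁)

AvoidingInteriorPoints : (m g t : ℕ) → Setoid 0ℓ 0ℓ
AvoidingInteriorPoints m g t =
  On.setoid {B = Σ (Vector ℤ m) (λ z → InInterior t z × AvoidsSubspaces g z)}
            (Fin m →-setoid ℤ) proj₁

{-# OPTIONS --safe #-}

-- The sum of z over a consecutive set {j,…,k} telescopes to x_k − x_{j−1}, so
-- nonempty consecutive sets are the same thing as pairs of markings i < j, and
-- their sums are the differences x_j − x_i.  Since the z_i are positive, two
-- nested consecutive sets with the same sum are equal.  Hence g + 1 distinct
-- representations of a positive integer are the same thing as g + 1
-- pairwise non-nested consecutive sets on which z has a common sum.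
module Submission where

open import Defs
open import Algebra.Bundles using (AbelianGroup)
open import Algebra.Properties.CommutativeMonoid.Sum using (sum-cong-≗)
open import Algebra.Properties.Group using (∙-cancelʳ)
open import Data.Bool.Base using (true; false; if_then_else_)
open import Data.Fin.Base as Fin using (Fin; zero; suc; toℕ; fromℕ; fromℕ<; inject₁; inject≤)
import Data.Fin.Properties as Fin
open import Data.Fin.Subset using (Subset; _∈_; _⊆_)
open import Data.Fin.Subset.Properties using (drop-there)
open import Data.Integer.Base using (ℤ; +_; 0ℤ; _+_; _-_; -_; _<_)
import Data.Integer.Properties as ℤ
open import Data.Integer.Tactic.RingSolver using (solve-∀)
open import Data.List.Base as List using (List; length; allFin; cartesianProduct)
import Data.List.Membership.Propositional as List
import Data.List.Membership.Setoid.Properties as SetoidMembership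
import Data.List.Membership.Propositional.Properties as List
import Data.List.Relation.Unary.All as All
open import Data.List.Relation.Unary.AllPairs.Core using (_∷_)
open import Data.List.Relation.Unary.Any using (index)
open import Data.List.Relation.Unary.Unique.Propositional using (Unique)
import Data.List.Relation.Unary.Unique.Propositional.Properties as Unique
open import Data.Nat.Base as ℕ using (ℕ; suc; NonZero; z≤n; s≤s; s<s; s<s⁻¹)
import Data.Nat.Properties as ℕ
open import Data.Product.Base using (Σ; ∃₂; _×_; _,_; proj₁; proj₂)
open import Data.Sum.Base using (inj₁; inj₂)
open import Data.Vec.Base using ([]; _∷_; here; there; lookup; tabulate)
open import Data.Vec.Functional using (Vector)
open import Data.Vec.Properties using ([]=⇒lookup; lookup⇒[]=; lookup∘tabulate)
open import Function.Base using (_∘_)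
open import Function.Bundles using (Bijection; Equivalence; _⇔_; mk⇔)
open import Relation.Binary.PropositionalEquality
open import Relation.Nullary using (¬_; Dec; yes; does; contradiction)
open import Relation.Nullary.Decidable using (_×-dec_; dec-true; decidable-stable)

open Equivalence using (to; from)

private
  variable
    m : ℕ
    i j i′ j′ : Fin (suc m)
    U V : Subset m

-- Monotonicity of the markings.

Increasing : Vector ℤ (suc m) → Set
Increasing {m} x = ∀ (i : Fin m) → x (inject₁ i) < x (suc i)

increasing⇒mono-< : (x : Vector ℤ (suc m)) → Increasing x →
                    ∀ i j → i Fin.< j → x i < x j
increasing⇒mono-< {suc _} x inc zero    (suc zero)    _ = inc zero
increasing⇒mono-< {suc _} x inc zero    (suc (suc j)) _ =
  ℤ.<-trans (inc zero) (increasing⇒mono-< (x ∘ suc) (inc ∘ suc) zero (suc j) (s≤s z≤n))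
increasing⇒mono-< {suc _} x inc (suc i) (suc j) (s≤s i<j) =
  increasing⇒mono-< (x ∘ suc) (inc ∘ suc) i j i<j

i<j⇒0<j-i : ∀ {a b : ℤ} → a < b → 0ℤ < b - a
i<j⇒0<j-i {a} {b} a<b = subst (_< b - a) (ℤ.+-inverseʳ a) (ℤ.+-monoˡ-< (- a) a<b)

0<j-i⇒i<j : ∀ {a b : ℤ} → 0ℤ < b - a → a < b
0<j-i⇒i<j {a} {b} 0<b-a =
  subst₂ _<_ (ℤ.+-identityˡ a) (b-a+a≡b a b) (ℤ.+-monoˡ-< a 0<b-a)
  where
  b-a+a≡b : ∀ a b → b - a + a ≡ b
  b-a+a≡b = solve-∀

-- Moving the right end to a later marking raises the minuend, and moving the left end to an earlier
-- one lowers the subtrahend. Either move alone makes the difference strictly larger, so equal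
-- differences rule out every case but the trivial one.
nested-equal : (x : Vector ℤ (suc m)) → Increasing x →
               i′ Fin.≤ i → j Fin.≤ j′ → x j - x i ≡ x j′ - x i′ →
               i ≡ i′ × j ≡ j′
nested-equal {i′ = i′} {i} {j} {j′} x inc i′≤i j≤j′ eq
  with ℕ.m≤n⇒m<n∨m≡n i′≤i | ℕ.m≤n⇒m<n∨m≡n j≤j′
... | inj₂ i′≡i | inj₂ j≡j′ = sym (Fin.toℕ-injective i′≡i) , Fin.toℕ-injective j≡j′
... | inj₂ i′≡i | inj₁ j<j′ with refl ← Fin.toℕ-injective i′≡i =
  contradiction (ℤ.+-monoˡ-< (- x i) (increasing⇒mono-< x inc j j′ j<j′)) (ℤ.<-irrefl eq)
... | inj₁ i′<i | inj₂ j≡j′ with refl ← Fin.toℕ-injective j≡j′ =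
  contradiction (ℤ.+-monoʳ-< (x j) (ℤ.neg-mono-< (increasing⇒mono-< x inc i′ i i′<i)))
                (ℤ.<-irrefl eq)
... | inj₁ i′<i | inj₁ j<j′ =
  contradiction (ℤ.+-mono-< (increasing⇒mono-< x inc j j′ j<j′)
                            (ℤ.neg-mono-< (increasing⇒mono-< x inc i′ i i′<i)))
                (ℤ.<-irrefl eq)

-- Consecutive sets of steps as pairs of markings.

-- With 0-based indices, U consists of the steps z_k lying between the markings
-- x_i and x_j.
Spans : Subset m → Fin (suc m) → Fin (suc m) → Set
Spans U i j = ∀ k → k ∈ U ⇔ (i Fin.≤ k × k Fin.< j)

spans? : (i j : Fin (suc m)) (k : Fin m) → Dec (i Fin.≤ k × k Fin.< j)
spans? i j k = (toℕ i ℕ.≤? toℕ k) ×-dec (toℕ k ℕ.<? toℕ j)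

interval : Fin (suc m) → Fin (suc m) → Subset m
interval i j = tabulate (does ∘ spans? i j)

does-true : ∀ {A : Set} (a? : Dec A) → does a? ≡ true → A
does-true (yes a) _ = a

spans-interval : (i j : Fin (suc m)) → Spans (interval i j) i j
spans-interval i j k = mk⇔
  (λ k∈ → does-true (spans? i j k)
            (trans (sym (lookup∘tabulate (does ∘ spans? i j) k)) ([]=⇒lookup k∈)))
  (λ p → lookup⇒[]= k _
           (trans (lookup∘tabulate (does ∘ spans? i j) k) (dec-true (spans? i j k) p)))

consecutive⇒spans : Consecutive U → ∃₂ λ i j → i Fin.< j × Spans U i j
consecutive⇒spans {U = U} (j , k , j≤k , U⇔) =
  -- Step `j` starts at marking `inject₁ j` and step `k` ends at marking `suc k`, so the closed
  -- range of steps becomes a half-open one.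
  inject₁ j , suc k , s≤s (subst (ℕ._≤ toℕ k) (sym j₁≡j) j≤k) , λ i → mk⇔
    (λ i∈U → let j≤i , i≤k = to (U⇔ i) i∈U in subst (ℕ._≤ toℕ i) (sym j₁≡j) j≤i , s≤s i≤k)
    (λ { (j≤i , s≤s i≤k) → from (U⇔ i) (subst (ℕ._≤ toℕ i) j₁≡j j≤i , i≤k) })
  where
  j₁≡j : toℕ (inject₁ j) ≡ toℕ j
  j₁≡j = Fin.toℕ-inject₁ j

spans⇒consecutive : i Fin.< j → Spans U i j → Consecutive U
spans⇒consecutive {i = i} {j = suc k} {U = U} (s≤s i≤k) spans =
  -- `i₀` is the step that starts at marking `i`; it exists because `i` is at most `k`, hence not
  -- the last marking.
  i₀ , k , subst (ℕ._≤ toℕ k) (sym i₀≡i) i≤k , λ l → mk⇔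
    (λ l∈U → let i≤l , l<j = to (spans l) l∈U in
             subst (ℕ._≤ toℕ l) (sym i₀≡i) i≤l , ℕ.s≤s⁻¹ l<j)
    (λ (i≤l , l≤k) → from (spans l) (subst (ℕ._≤ toℕ l) i₀≡i i≤l , s≤s l≤k))
  where
  i<m  = ℕ.≤-<-trans i≤k (Fin.toℕ<n k)
  i₀   = fromℕ< i<m
  i₀≡i = Fin.toℕ-fromℕ< i<m

-- It suffices to test the inclusion on the first step `i₀` and the last step `k` of `U`, both
-- present because `i` lies strictly before `j`.
spans-⊆⇒nested : i Fin.< j → Spans U i j → Spans V i′ j′ → U ⊆ V →
                 i′ Fin.≤ i × j Fin.≤ j′
spans-⊆⇒nested {i = i} {j = suc k} {i′ = i′} (s≤s i≤k) spansU spansV U⊆V =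
  subst (toℕ i′ ℕ.≤_) i₀≡i
    (proj₁ (to (spansV i₀) (U⊆V (from (spansU i₀)
      (ℕ.≤-reflexive (sym i₀≡i) , s≤s (subst (ℕ._≤ toℕ k) (sym i₀≡i) i≤k)))))) ,
  proj₂ (to (spansV k) (U⊆V (from (spansU k) (i≤k , ℕ.≤-refl))))
  where
  i<m  = ℕ.≤-<-trans i≤k (Fin.toℕ<n k)
  i₀   = fromℕ< i<m
  i₀≡i = Fin.toℕ-fromℕ< i<m

spans⇒⊆ : Spans U i j → Spans V i j → U ⊆ V
spans⇒⊆ spansU spansV {k} = from (spansV k) ∘ to (spansU k)

-- Telescoping sums over consecutive sets.

b-a+[c-b]≡c-a : ∀ a b c → (b - a) + (c - b) ≡ c - a
b-a+[c-b]≡c-a = solve-∀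

-- Induction on `U`, removing the first step. Once the left end is `zero`, each removal shortens the
-- interval until it is empty, which is why `i` and `j` may coincide. Then both sides are zero. The
-- absurd cases are those whose first bit disagrees with the interval.
sumOver-spans : (U : Subset m) (x : Vector ℤ (suc m)) (i j : Fin (suc m)) → i Fin.≤ j →
                Spans U i j → sumOver U (differences x) ≡ x j - x i
sumOver-spans [] x zero zero _ _ = sym (ℤ.+-inverseʳ (x zero))
sumOver-spans (true ∷ U) x zero zero _ spans =
  contradiction (proj₂ (to (spans zero) here)) λ ()
sumOver-spans (false ∷ U) x zero zero _ spans = begin
  0ℤ + sumOver U (differences (x ∘ suc))  ≡⟨ ℤ.+-identityˡ _ ⟩
  sumOver U (differences (x ∘ suc))       ≡⟨ sumOver-spans U (x ∘ suc) zero zero z≤n spans′ ⟩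
  x (suc zero) - x (suc zero)             ≡⟨ ℤ.+-inverseʳ (x (suc zero)) ⟩
  0ℤ                                      ≡⟨ ℤ.+-inverseʳ (x zero) ⟨
  x zero - x zero                         ∎
  where
  open ≡-Reasoning
  spans′ : Spans U zero zero
  spans′ k = mk⇔ (λ k∈U → contradiction (proj₂ (to (spans (suc k)) (there k∈U))) λ ()) λ ()
sumOver-spans (false ∷ U) x zero (suc j) _ spans =
  contradiction (from (spans zero) (z≤n , s≤s z≤n)) λ ()
sumOver-spans (true ∷ U) x zero (suc j) _ spans = begin
  x (suc zero) - x zero + sumOver U (differences (x ∘ suc))
    ≡⟨ cong (λ w → x (suc zero) - x zero + w) (sumOver-spans U (x ∘ suc) zero j z≤n spans′) ⟩
  (x (suc zero) - x zero) + (x (suc j) - x (suc zero))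
    ≡⟨ b-a+[c-b]≡c-a (x zero) (x (suc zero)) (x (suc j)) ⟩
  x (suc j) - x zero ∎
  where
  open ≡-Reasoning
  spans′ : Spans U zero j
  spans′ k = mk⇔ (λ k∈U → z≤n , s<s⁻¹ (proj₂ (to (spans (suc k)) (there k∈U))))
                 (λ (_ , k<j) → drop-there (from (spans (suc k)) (z≤n , s<s k<j)))
sumOver-spans (true ∷ U) x (suc i) (suc j) _ spans =
  contradiction (proj₁ (to (spans zero) here)) λ ()
sumOver-spans (false ∷ U) x (suc i) (suc j) (s≤s i≤j) spans =
  trans (ℤ.+-identityˡ _) (sumOver-spans U (x ∘ suc) i j i≤j spans′)
  where
  spans′ : Spans U i j
  spans′ k = mk⇔ (λ k∈U → let p , q = to (spans (suc k)) (there k∈U) in ℕ.s≤s⁻¹ p , s<s⁻¹ q)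
                 (λ (p , q) → drop-there (from (spans (suc k)) (s≤s p , s<s q)))

sumOver-cong : (U : Subset m) {y z : Vector ℤ m} → y ≗ z → sumOver U y ≡ sumOver U z
sumOver-cong U y≗z =
  sum-cong-≗ ℤ.+-0-commutativeMonoid
    (λ i → cong (λ w → if lookup U i then w else 0ℤ) (y≗z i))

-- Needed for the inverse map, since the differences of the partial sums of `z` agree with `z` only
-- pointwise.
avoidsSubspaces-resp-≗ : ∀ g {y z : Vector ℤ m} → y ≗ z →
                         AvoidsSubspaces g y → AvoidsSubspaces g z
avoidsSubspaces-resp-≗ g y≗z avoids U cons none inSub = avoids U cons none λ a b →
  trans (sumOver-cong (U a) y≗z) (trans (inSub a b) (sym (sumOver-cong (U b) y≗z)))

-- Representations as entries of a list.

Represents : Vector ℤ m → ℤ → Fin m × Fin m → Set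
Represents x n (i , j) = i Fin.< j × x j - x i ≡ n

∈-representations : (x : Vector ℤ m) (n : ℤ) (p : Fin m × Fin m) →
                    p List.∈ representations x n ⇔ Represents x n p
∈-representations {m} x n p@(i , j) = mk⇔
  (λ p∈ → proj₂ (List.∈-filter⁻ represents? {xs = pairs} p∈))
  (List.∈-filter⁺ represents?
    (List.∈-cartesianProduct⁺ (List.∈-allFin i) (List.∈-allFin j)))
  where
  pairs = cartesianProduct (allFin m) (allFin m)
  represents? : ∀ p → Dec (Represents x n p)
  represents? (i , j) = (i Fin.<? j) ×-dec (x j - x i ℤ.≟ n)

representations-unique : (x : Vector ℤ m) (n : ℤ) → Unique (representations x n)
representations-unique {m} x n =
  Unique.filter⁺ _ (Unique.cartesianProduct⁺ (Unique.allFin⁺ m) (Unique.allFin⁺ m))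

-- This lets a long list of representations yield genuinely different ones: distinct positions hold
-- distinct pairs.
unique⇒lookup-injective : ∀ {A : Set} {xs : List A} → Unique xs →
                          ∀ i j → List.lookup xs i ≡ List.lookup xs j → i ≡ j
unique⇒lookup-injective (_  ∷ _)  zero    zero    _  = refl
unique⇒lookup-injective (x∉ ∷ _)  zero    (suc j) eq =
  contradiction eq (All.lookup x∉ (List.∈-lookup j))
unique⇒lookup-injective (x∉ ∷ _)  (suc i) zero    eq =
  contradiction (sym eq) (All.lookup x∉ (List.∈-lookup i))
unique⇒lookup-injective (_  ∷ xs!) (suc i) (suc j) eq =
  cong suc (unique⇒lookup-injective xs! i j eq)

-- Few representations versus avoided subspaces.

isB₂⁻⇒avoidsSubspaces : ∀ g (x : Vector ℤ (suc m)) → Increasing x →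
                        IsB₂⁻[ g ] x → AvoidsSubspaces g (differences x)
isB₂⁻⇒avoidsSubspaces g x inc isB₂ U cons none inSub =
  -- Pigeonhole: the `suc g` blocks inject into the positions of a list of length at most `g`.
  ℕ.<⇒≱ (Fin.injective⇒≤ index-injective) (isB₂ n n>0)
  where
  ends : Fin (suc g) → _
  ends a = let i , j , _ = consecutive⇒spans (cons a) in i , j
  i<j : ∀ a → proj₁ (ends a) Fin.< proj₂ (ends a)
  i<j a = let _ , _ , i<j , _ = consecutive⇒spans (cons a) in i<j
  spans : ∀ a → Spans (U a) (proj₁ (ends a)) (proj₂ (ends a))
  spans a = let _ , _ , _ , spans = consecutive⇒spans (cons a) in spans
  difference : ∀ a → sumOver (U a) (differences x) ≡ x (proj₂ (ends a)) - x (proj₁ (ends a))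
  difference a = sumOver-spans (U a) x _ _ (ℕ.<⇒≤ (i<j a)) (spans a)
  n : ℤ
  n = sumOver (U zero) (differences x)
  n>0 : 0ℤ < n
  n>0 = subst (0ℤ <_) (sym (difference zero)) (i<j⇒0<j-i (increasing⇒mono-< x inc _ _ (i<j zero)))
  ends∈ : ∀ a → ends a List.∈ representations x n
  ends∈ a = from (∈-representations x n (ends a))
                 (i<j a , trans (sym (difference a)) (inSub a zero))
  index-injective : ∀ {a b} → index (ends∈ a) ≡ index (ends∈ b) → a ≡ b
  -- Equal positions give equal end markings, so `U a` is contained in `U b`, which `none` forbids
  -- for distinct indices.
  index-injective {a} {b} eq = decidable-stable (a Fin.≟ b) λ a≢b →
    none a b a≢b (spans⇒⊆ (spans a) (subst (λ (i , j) → Spans (U b) i j)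
      (sym (SetoidMembership.index-injective (setoid _) (ends∈ a) (ends∈ b) eq)) (spans b)))

avoidsSubspaces⇒isB₂⁻ : ∀ g (x : Vector ℤ (suc m)) → Increasing x →
                        AvoidsSubspaces g (differences x) → IsB₂⁻[ g ] x
avoidsSubspaces⇒isB₂⁻ {m} g x inc avoids n _ = ℕ.≮⇒≥ tooMany
  where
  tooMany : ¬ g ℕ.< length (representations x n)
  tooMany g<len = avoids block
    (λ a → spans⇒consecutive (proj₁ (rep a)) (spans a))
    none
    (λ a b → trans (difference a) (sym (difference b)))
    where
    -- The first `suc g` entries of the list supply the blocks.
    pos : Fin (suc g) → Fin (length (representations x n))
    pos a = inject≤ a g<len
    left right : Fin (suc g) → Fin (suc m)
    left a = proj₁ (List.lookup (representations x n) (pos a))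
    right a = proj₂ (List.lookup (representations x n) (pos a))
    rep : ∀ a → Represents x n (left a , right a)
    rep a = to (∈-representations x n _) (List.∈-lookup (pos a))
    block : Fin (suc g) → Subset m
    block a = interval (left a) (right a)
    spans : ∀ a → Spans (block a) (left a) (right a)
    spans a = spans-interval (left a) (right a)
    difference : ∀ a → sumOver (block a) (differences x) ≡ n
    difference a = trans (sumOver-spans (block a) x _ _ (ℕ.<⇒≤ (proj₁ (rep a))) (spans a))
                         (proj₂ (rep a))
    none : NoneContained block
    -- Containment nests the end markings; the common difference `n` then makes the two pairs equal,
    -- and so the positions.
    none a b a≢b a⊆b =
      let i′≤i , j≤j′ = spans-⊆⇒nested (proj₁ (rep a)) (spans a) (spans b) a⊆b
          i≡i′ , j≡j′ = nested-equal x inc i′≤i j≤j′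
                          (trans (proj₂ (rep a)) (sym (proj₂ (rep b))))
      in a≢b (Fin.inject≤-injective g<len g<len a b
               (unique⇒lookup-injective (representations-unique x n) _ _
                 (cong₂ _,_ i≡i′ j≡j′)))

-- Passing between markings and differences.

sum-differences : (x : Vector ℤ (suc m)) → sum (differences x) ≡ x (fromℕ m) - x zero
sum-differences {ℕ.zero} x = sym (ℤ.+-inverseʳ (x zero))
sum-differences {suc m}  x = begin
  x (suc zero) - x zero + sum (differences (x ∘ suc))
    ≡⟨ cong (λ w → x (suc zero) - x zero + w) (sum-differences (x ∘ suc)) ⟩
  (x (suc zero) - x zero) + (x (fromℕ (suc m)) - x (suc zero))
    ≡⟨ b-a+[c-b]≡c-a (x zero) (x (suc zero)) (x (fromℕ (suc m))) ⟩
  x (fromℕ (suc m)) - x zero ∎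
  where open ≡-Reasoning

-- The first marking and the first difference determine the second marking, which is the starting
-- value of the tail.
differences-injective : {x y : Vector ℤ (suc m)} → x zero ≡ y zero →
                        differences x ≗ differences y → x ≗ y
differences-injective x₀≡y₀ d≗ zero = x₀≡y₀
differences-injective {suc _} {x} {y} x₀≡y₀ d≗ (suc i) =
  differences-injective {x = x ∘ suc} {y ∘ suc} x₁≡y₁ (d≗ ∘ suc) i
  where
  x₁≡y₁ : x (suc zero) ≡ y (suc zero)
  x₁≡y₁ = ∙-cancelʳ (AbelianGroup.group ℤ.+-0-abelianGroup) (- x zero) _ _
    (trans (d≗ zero) (cong (λ w → y (suc zero) - w) (sym x₀≡y₀)))

-- The starting value `c` is an accumulator, so that the tail is again a vector of partial sums and
-- inductions can drop the first marking.
partialSums : ℤ → Vector ℤ m → Vector ℤ (suc m)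
partialSums c z zero = c
partialSums {suc m} c z (suc i) = partialSums (c + z zero) (z ∘ suc) i

differences-partialSums : ∀ c (z : Vector ℤ m) → differences (partialSums c z) ≗ z
differences-partialSums c z zero = c+w-c≡w c (z zero)
  where
  c+w-c≡w : ∀ c w → c + w - c ≡ w
  c+w-c≡w = solve-∀
differences-partialSums {suc (suc _)} c z (suc i) =
  differences-partialSums (c + z zero) (z ∘ suc) i

-- The bijection.

module _ {m g t : ℕ} where

  toPoint : Σ (Ruler m t) (λ r → IsB₂⁻[ g ] (marking r)) →
            Σ (Vector ℤ m) (λ z → InInterior t z × AvoidsSubspaces g z)
  toPoint (r , isB₂) =
    differences (marking r) ,
    ((λ i → i<j⇒0<j-i (increasing r i)) , sum≡t) ,
    isB₂⁻⇒avoidsSubspaces g (marking r) (increasing r) isB₂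
    where
    sum≡t : sum (differences (marking r)) ≡ + t
    sum≡t = trans (sum-differences (marking r))
      (trans (cong₂ _-_ (end r) (start r)) (ℤ.+-identityʳ (+ t)))

  toRuler : Σ (Vector ℤ m) (λ z → InInterior t z × AvoidsSubspaces g z) →
            Σ (Ruler m t) (λ r → IsB₂⁻[ g ] (marking r))
  toRuler (z , (z>0 , sum≡t) , avoids) =
    record { marking = x ; start = refl ; increasing = inc ; end = x-end } ,
    avoidsSubspaces⇒isB₂⁻ g x inc (avoidsSubspaces-resp-≗ g (sym ∘ dx≗z) avoids)
    where
    x : Vector ℤ (suc m)
    x = partialSums 0ℤ z
    dx≗z : differences x ≗ z
    dx≗z = differences-partialSums 0ℤ z
    inc : Increasing x
    inc i = 0<j-i⇒i<j (subst (0ℤ <_) (sym (dx≗z i)) (z>0 i))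
    x-end : x (fromℕ m) ≡ + t
    x-end = begin
      -- `x zero` computes to `0ℤ`, so subtracting it amounts to adding zero.
      x (fromℕ m)          ≡⟨ ℤ.+-identityʳ _ ⟨
      x (fromℕ m) - x zero ≡⟨ sum-differences x ⟨
      sum (differences x)  ≡⟨ sum-cong-≗ ℤ.+-0-commutativeMonoid dx≗z ⟩
      sum z                ≡⟨ sum≡t ⟩
      + t                  ∎
      where open ≡-Reasoning

differences-cong : {x y : Vector ℤ (suc m)} → x ≗ y → differences x ≗ differences y
differences-cong x≗y i = cong₂ _-_ (x≗y (suc i)) (x≗y (inject₁ i))

proposition3p8 : (m g t : ℕ) .{{_ : NonZero m}} .{{_ : NonZero g}} .{{_ : NonZero t}} →
    Σ (Bijection (B₂⁻Rulers m g t) (AvoidingInteriorPoints m g t)) λ f →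
    ∀ r → proj₁ (Bijection.to f r) ≗ differences (marking (proj₁ r))
proposition3p8 m g t =
  record
    { to        = toPoint
    ; cong      = differences-cong
    ; bijective =
        (λ {(r , _)} {(s , _)} → differences-injective (trans (start r) (sym (start s)))) ,
        -- Surjectivity is required for every ruler pointwise equal to the chosen preimage, hence
        -- the use of `differences-cong`.
        (λ p@(z , _) → toRuler p , λ r≗ i →
          trans (differences-cong r≗ i) (differences-partialSums 0ℤ z i))
    } ,
  λ _ _ → refl
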